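{- Let $n \ge 2$ and let $S_n$ be the star on $n$ vertices. Then $l(-(K_1 \vee S_n)) = 1$, while $l_{\max}(K_1 \vee S_n) = \left\lfloor \frac{n}{2} \right\rfloor$.
   Context: All graphs are finite, simple and undirected. A signed graph $\Sigma=(G,\sigma)$ is a graph $G$ with a signature $\sigma:E(G)\to\{+1,-1\}$. The sign of a cycle is the product of the signs of its edges; $\Sigma$ is balanced if all its cycles are positive. The frustration index $l(\Sigma)$ is the minimum number of edges whose deletion makes $\Sigma$ balanced. $-G$ is $G$ with all edges signed $-1$. $l_{\max}(G)=\max_\sigma l(G,\sigma)$ over all signatures of $G$. $G_1\vee G_2$ denotes the join of vertex-disjoint graphs. The star $S_n$ on $n$ vertices is the tree $K_{1,n-1}$. -}

module Defs where

open import Data.Bool.Base as Bool using (Bool; true; false; T; not; if_then_else_)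
open import Data.Bool.Properties using (∨-comm; T-irrelevant; T?)
open import Data.Fin.Base using (Fin; zero; suc; splitAt; _<_)
open import Data.Fin.Properties using (_≟_; _<?_; <-cmp; all?; injective⇒≤)
open import Data.List.Base using (List; []; _∷_; _++_; map; filter; length; lookup; allFin; cartesianProduct)
open import Data.List.Extrema.Nat using (min; max; xs≤max)
open import Data.List.Membership.Propositional using (_∈_)
open import Data.List.Membership.Propositional.Properties using (∈-map⁺; ∈-++⁺ˡ; ∈-++⁺ʳ; ∈-filter⁺; ∈-filter⁻; ∈-lookup; ∈-allFin; ∈-cartesianProduct⁺)
open import Data.List.Properties using (filter-≐)
open import Data.List.Relation.Unary.All as All using ()
open import Data.List.Relation.Unary.AllPairs as AllPairs using ()
open import Data.List.Relation.Unary.Any using (here)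
open import Data.List.Relation.Unary.Unique.Propositional using (Unique)
open import Data.Nat.Base as ℕ using (ℕ; zero; suc; _+_; _∸_; _≤_; z≤n; s≤s)
open import Data.Nat.Properties using (_≤?_)
open import Data.Product.Base using (_×_; _,_; proj₁; proj₂; ∃-syntax)
open import Data.Product.Properties using (≡-dec)
open import Data.Sign as Sign using (Sign)
open import Data.Sign.Properties using () renaming (_≟_ to _≟ˢ_)
open import Data.Sum.Base using (_⊎_; inj₁; inj₂)
open import Function.Base using (_∘_)
open import Level using (0ℓ)
open import Relation.Binary.Core using (Rel)
open import Relation.Binary.Construct.Closure.ReflexiveTransitive using (Star; ε; _◅_)
open import Relation.Binary.Definitions using (tri<; tri≈; tri>)
open import Relation.Binary.PropositionalEquality using (_≡_; refl; sym; trans; cong; cong₂; subst)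
open import Relation.Nullary using (¬_; Dec; yes; no; does; ⌊_⌋; map′; _×-dec_; _→-dec_; contradiction)

import Data.List.Membership.DecPropositional as DecMembership
import Data.List.Relation.Unary.Unique.DecPropositional as DecUnique

record Graph : Set where
  field
    order      : ℕ
    adj        : Fin order → Fin order → Bool
    adj-sym    : ∀ u v → adj u v ≡ adj v u
    adj-irrefl : ∀ u → adj u u ≡ false

  Vertex : Set
  Vertex = Fin order

  Adj : Rel Vertex 0ℓ
  Adj u v = T (adj u v)

open Graph public

private
  ≟-comm : ∀ {n} (u v : Fin n) → ⌊ u ≟ v ⌋ ≡ ⌊ v ≟ u ⌋
  ≟-comm u v with u ≟ v | v ≟ u
  ... | yes _   | yes _   = refl
  ... | no  _   | no  _   = refl
  ... | yes u≡v | no  v≢u = contradiction (sym u≡v) v≢u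
  ... | no  u≢v | yes v≡u = contradiction (sym v≡u) u≢v

  ≟-diag : ∀ {n} (u : Fin n) → ⌊ u ≟ u ⌋ ≡ true
  ≟-diag u with u ≟ u
  ... | yes _   = refl
  ... | no  u≢u = contradiction refl u≢u

K : ℕ → Graph
K n = record
  { order      = n
  ; adj        = λ u v → not ⌊ u ≟ v ⌋
  ; adj-sym    = λ u v → cong not (≟-comm u v)
  ; adj-irrefl = λ u → cong not (≟-diag u)
  }

edgeless : ℕ → Graph
edgeless n = record
  { order      = n
  ; adj        = λ _ _ → false
  ; adj-sym    = λ _ _ → refl
  ; adj-irrefl = λ _ → refl
  }

infixr 5 _∨_

-- `splitAt` presents the vertex set of the join as the disjoint union of
-- the vertex sets of the two graphs.

_∨_ : Graph → Graph → Graph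
G ∨ H = record
  { order      = order G + order H
  ; adj        = λ u v → joinAdj (split u) (split v)
  ; adj-sym    = λ u v → joinAdj-sym (split u) (split v)
  ; adj-irrefl = λ u → joinAdj-irrefl (split u)
  }
  where
  split : Fin (order G + order H) → Vertex G ⊎ Vertex H
  split = splitAt (order G)

  joinAdj : Vertex G ⊎ Vertex H → Vertex G ⊎ Vertex H → Bool
  joinAdj (inj₁ u) (inj₁ v) = adj G u v
  joinAdj (inj₂ u) (inj₂ v) = adj H u v
  joinAdj (inj₁ _) (inj₂ _) = true
  joinAdj (inj₂ _) (inj₁ _) = true

  joinAdj-sym : ∀ x y → joinAdj x y ≡ joinAdj y x
  joinAdj-sym (inj₁ u) (inj₁ v) = adj-sym G u v
  joinAdj-sym (inj₂ u) (inj₂ v) = adj-sym H u v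
  joinAdj-sym (inj₁ _) (inj₂ _) = refl
  joinAdj-sym (inj₂ _) (inj₁ _) = refl

  joinAdj-irrefl : ∀ x → joinAdj x x ≡ false
  joinAdj-irrefl (inj₁ u) = adj-irrefl G u
  joinAdj-irrefl (inj₂ u) = adj-irrefl H u

K⟨_,_⟩ : ℕ → ℕ → Graph
K⟨ m , n ⟩ = edgeless m ∨ edgeless n

-- The star on n vertices; only meaningful for n ≥ 1.

S : ℕ → Graph
S n = K⟨ 1 , n ∸ 1 ⟩

-- The edge uv with u < v is represented by the pair (u , v).

edges : (G : Graph) → List (Vertex G × Vertex G)
edges G = filter (λ (u , v) → (u <? v) ×-dec T? (adj G u v))
                 (cartesianProduct (allFin (order G)) (allFin (order G)))

-- Since `edges G` has no repetitions, its sublists are exactly the sets of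
-- edges of G, each listed once.

sublists : ∀ {a} {A : Set a} → List A → List (List A)
sublists []       = [] ∷ []
sublists (x ∷ xs) = map (x ∷_) (sublists xs) ++ sublists xs

edgeSets : (G : Graph) → List (List (Vertex G × Vertex G))
edgeSets G = sublists (edges G)

module _ {n : ℕ} where

  open DecMembership (≡-dec (_≟_ {n}) (_≟_ {n})) using (_∈?_)

  joins : List (Fin n × Fin n) → Fin n → Fin n → Bool
  joins F u v = ⌊ (u , v) ∈? F ⌋ Bool.∨ ⌊ (v , u) ∈? F ⌋

  joins-sym : ∀ F u v → joins F u v ≡ joins F v u
  joins-sym F u v = ∨-comm ⌊ (u , v) ∈? F ⌋ ⌊ (v , u) ∈? F ⌋

  joins-cases : ∀ F u v →
    (((u , v) ∈ F ⊎ (v , u) ∈ F) × joins F u v ≡ true) ⊎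
    (¬ (u , v) ∈ F × ¬ (v , u) ∈ F × joins F u v ≡ false)
  joins-cases F u v with (u , v) ∈? F | (v , u) ∈? F
  ... | yes uv∈F | _        = inj₁ (inj₁ uv∈F , refl)
  ... | no  _    | yes vu∈F = inj₁ (inj₂ vu∈F , refl)
  ... | no  uv∉F | no  vu∉F = inj₂ (uv∉F , vu∉F , refl)

infixl 6 _─_

_─_ : (G : Graph) → List (Vertex G × Vertex G) → Graph
G ─ F = record
  { order      = order G
  ; adj        = λ u v → adj G u v Bool.∧ not (joins F u v)
  ; adj-sym    = λ u v → cong₂ Bool._∧_ (adj-sym G u v) (cong not (joins-sym F u v))
  ; adj-irrefl = λ u → cong (Bool._∧ not (joins F u u)) (adj-irrefl G u)
  }

─-Adj⇒Adj : ∀ G F u v → Adj (G ─ F) u v → Adj G u v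
─-Adj⇒Adj G F u v p with adj G u v
... | true = _

-- A sign for each unordered pair of adjacent vertices.

record Signature (G : Graph) : Set where
  field
    sign     : ∀ u v → Adj G u v → Sign
    sign-sym : ∀ u v (p : Adj G u v) (q : Adj G v u) → sign u v p ≡ sign v u q

open Signature public

infix 4 _,ˢ_

record SignedGraph : Set where
  constructor _,ˢ_
  field
    graph     : Graph
    signature : Signature graph

open SignedGraph public

infix 8 -_

-_ : Graph → SignedGraph
- G = G ,ˢ record { sign = λ _ _ _ → Sign.- ; sign-sym = λ _ _ _ _ → refl }

delete : (Σ : SignedGraph) → List (Vertex (graph Σ) × Vertex (graph Σ)) → SignedGraph
delete (G ,ˢ σ) F = G ─ F ,ˢ record
  { sign     = λ u v p → sign σ u v (─-Adj⇒Adj G F u v p)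
  ; sign-sym = λ u v p q → sign-sym σ u v (─-Adj⇒Adj G F u v p) (─-Adj⇒Adj G F v u q)
  }

Walk : (G : Graph) → Rel (Vertex G) 0ℓ
Walk G = Star (Adj G)

-- The final vertex is left out, so that a closed walk lists its base once.

vertices : ∀ G {u v} → Walk G u v → List (Vertex G)
vertices G ε                 = []
vertices G (_◅_ {i = u} _ w) = u ∷ vertices G w

record Cycle (G : Graph) : Set where
  field
    base     : Vertex G
    walk     : Walk G base base
    distinct : Unique (vertices G walk)
    long     : 3 ≤ length (vertices G walk)

open Cycle public

walkSign : ∀ {G} → Signature G → ∀ {u v} → Walk G u v → Sign
walkSign σ ε                         = Sign.+
walkSign σ (_◅_ {i = u} {j = v} p w) = sign σ u v p Sign.* walkSign σ w

cycleSign : (Σ : SignedGraph) → Cycle (graph Σ) → Sign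
cycleSign (_ ,ˢ σ) c = walkSign σ (walk c)

Balanced : SignedGraph → Set
Balanced Σ = (c : Cycle (graph Σ)) → cycleSign Σ c ≡ Sign.+

-- Balance is decidable because a cycle has at most as many edges as the graph has
-- vertices, so only finitely many walks need to be inspected.

module _ (G : Graph) where

  private
    len : ∀ {u v} → Walk G u v → ℕ
    len w = length (vertices G w)

  allWalks? : ∀ b u v {P : Walk G u v → Set} → (∀ w → Dec (P w)) →
              Dec (∀ w → len w ≤ b → P w)
  allWalks? b u v {P} P? = map′ combine split (empty? ×-dec step? b)
    where
    Empty : Set
    Empty = (u≡v : u ≡ v) → P (subst (Walk G u) u≡v ε)

    Step : ℕ → Set
    Step b = ∀ x (p : Adj G u x) (w : Walk G x v) → suc (len w) ≤ b → P (p ◅ w)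

    empty? : Dec Empty
    empty? with u ≟ v
    ... | no  u≢v  = yes (λ u≡v → contradiction u≡v u≢v)
    ... | yes refl = map′ (λ { Pε refl → Pε }) (λ f → f refl) (P? ε)

    step? : ∀ b → Dec (Step b)
    step? zero    = yes (λ _ _ _ ())
    step? (suc b) = all? next?
      where
      next? : ∀ x → Dec ((p : Adj G u x) (w : Walk G x v) → suc (len w) ≤ suc b → P (p ◅ w))
      next? x with T? (adj G u x)
      ... | no ¬p = yes (λ p → contradiction p ¬p)
      ... | yes p = map′
        (λ f q w l → subst (λ r → P (r ◅ w)) (T-irrelevant p q) (f w (ℕ.s≤s⁻¹ l)))
        (λ f w l → f p w (s≤s l))
        (allWalks? b x v (P? ∘ (p ◅_)))

    combine : Empty × Step b → ∀ w → len w ≤ b → P w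
    combine (e , _) ε       _ = e refl
    combine (_ , s) (p ◅ w) l = s _ p w l

    split : (∀ w → len w ≤ b → P w) → Empty × Step b
    split f = (λ { refl → f ε z≤n }) , (λ _ p w l → f (p ◅ w) l)

private
  lookup-injective : ∀ {a} {A : Set a} {xs : List A} → Unique xs →
                     ∀ {i j} → lookup xs i ≡ lookup xs j → i ≡ j
  lookup-injective (_ AllPairs.∷ _)  {zero}  {zero}  _  = refl
  lookup-injective (x≢ AllPairs.∷ _) {zero}  {suc j} eq =
    contradiction eq (All.lookup x≢ (∈-lookup j))
  lookup-injective (x≢ AllPairs.∷ _) {suc i} {zero}  eq =
    contradiction (sym eq) (All.lookup x≢ (∈-lookup i))
  lookup-injective (_ AllPairs.∷ u)  {suc i} {suc j} eq =
    cong suc (lookup-injective u eq)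

cycle-length : ∀ {G} (c : Cycle G) → length (vertices G (walk c)) ≤ order G
cycle-length c = injective⇒≤ (lookup-injective (distinct c))

balanced? : (Σ : SignedGraph) → Dec (Balanced Σ)
balanced? (G ,ˢ σ) = map′
  (λ f c → f (base c) (walk c) (cycle-length c) (distinct c) (long c))
  (λ f v w _ d l → f (record { base = v ; walk = w ; distinct = d ; long = l }))
  (all? λ v → allWalks? G (order G) v v λ w →
    DecUnique.unique? _≟_ (vertices G w) →-dec
    (3 ≤? length (vertices G w)) →-dec
    (walkSign σ w ≟ˢ Sign.+))

-- The first argument of `min` is only a default and does not lower the
-- minimum: `edges G` is itself one of the edge sets, and deleting it leaves
-- no cycles at all.

l : SignedGraph → ℕ
l Σ = min (length (edges (graph Σ)))
          (map length (filter (λ F → balanced? (delete Σ F)) (edgeSets (graph Σ))))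

-- The signature that is negative exactly on the edges in N.

negativeOn : ∀ G → List (Vertex G × Vertex G) → Signature G
negativeOn G N = record
  { sign     = λ u v _ → if joins N u v then Sign.- else Sign.+
  ; sign-sym = λ u v _ _ → cong (if_then Sign.- else Sign.+) (joins-sym N u v)
  }

-- That these are all signatures of G, up to pointwise equality, is
-- `signatures-complete` below.

signatures : (G : Graph) → List (Signature G)
signatures G = map (negativeOn G) (edgeSets G)

lmax : Graph → ℕ
lmax G = max 0 (map (λ σ → l (G ,ˢ σ)) (signatures G))

infix 4 _≈ˢ_

_≈ˢ_ : ∀ {G} → Rel (Signature G) 0ℓ
_≈ˢ_ {G} σ τ = ∀ u v (p : Adj G u v) → sign σ u v p ≡ sign τ u v p

l-cong : ∀ {G} (σ τ : Signature G) → σ ≈ˢ τ → l (G ,ˢ σ) ≡ l (G ,ˢ τ)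
l-cong {G} σ τ σ≈τ =
  cong (min (length (edges G)) ∘ map length)
    (filter-≐ (λ F → balanced? (delete (G ,ˢ σ) F)) (λ F → balanced? (delete (G ,ˢ τ) F))
      ( (λ {F} b c → trans (sym (walk≡ F (walk c))) (b c))
      , (λ {F} b c → trans (walk≡ F (walk c)) (b c)))
      (edgeSets G))
  where
  walk≡ : ∀ F {u v} (w : Walk (G ─ F) u v) →
          walkSign (signature (delete (G ,ˢ σ) F)) w ≡
          walkSign (signature (delete (G ,ˢ τ) F)) w
  walk≡ F ε       = refl
  walk≡ F (p ◅ w) = cong₂ Sign._*_ (σ≈τ _ _ (─-Adj⇒Adj G F _ _ p)) (walk≡ F w)

filter∈sublists : ∀ {a p} {A : Set a} {P : A → Set p} (P? : ∀ x → Dec (P x)) xs →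
                  filter P? xs ∈ sublists xs
filter∈sublists P? []       = here refl
filter∈sublists P? (x ∷ xs) with does (P? x)
... | true  = ∈-++⁺ˡ (∈-map⁺ (x ∷_) (filter∈sublists P? xs))
... | false = ∈-++⁺ʳ (map (x ∷_) (sublists xs)) (filter∈sublists P? xs)

signatures-complete : ∀ {G} (σ : Signature G) → ∃[ τ ] τ ∈ signatures G × σ ≈ˢ τ
signatures-complete {G} σ =
  negativeOn G N , ∈-map⁺ (negativeOn G) (filter∈sublists negative? (edges G)) , σ≈N
  where
  Negative : Vertex G × Vertex G → Set
  Negative (u , v) = ∃[ p ] sign σ u v p ≡ Sign.-

  negative? : ∀ e → Dec (Negative e)
  negative? (u , v) with T? (adj G u v)
  ... | no ¬p = no (¬p ∘ proj₁)
  ... | yes p = map′ (p ,_)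
                     (λ (q , eq) → trans (cong (sign σ u v) (T-irrelevant p q)) eq)
                     (sign σ u v p ≟ˢ Sign.-)

  N : List (Vertex G × Vertex G)
  N = filter negative? (edges G)

  ∈N : ∀ {u v} → u < v → (p : Adj G u v) → sign σ u v p ≡ Sign.- → (u , v) ∈ N
  ∈N u<v p eq = ∈-filter⁺ negative?
    (∈-filter⁺ _ (∈-cartesianProduct⁺ (∈-allFin _) (∈-allFin _)) (u<v , p))
    (p , eq)

  ∈N⇒- : ∀ {e} → e ∈ N → Negative e
  ∈N⇒- e∈N = proj₂ (∈-filter⁻ negative? {xs = edges G} e∈N)

  flip : ∀ {u v} → Adj G u v → Adj G v u
  flip {u} {v} = subst T (adj-sym G u v)

  ∉N⇒+ : ∀ {u v} (p : Adj G u v) → ¬ (u , v) ∈ N → ¬ (v , u) ∈ N →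
         sign σ u v p ≡ Sign.+
  ∉N⇒+ {u} {v} p uv∉N vu∉N with sign σ u v p in eq
  ... | Sign.+ = refl
  ... | Sign.- with <-cmp u v
  ...   | tri< u<v _ _  = contradiction (∈N u<v p eq) uv∉N
  ...   | tri≈ _ refl _ = contradiction (subst T (adj-irrefl G u) p) λ ()
  ...   | tri> _ _ v<u  = contradiction
    (∈N v<u (flip p) (trans (sign-sym σ v u (flip p) p) eq)) vu∉N

  σ≈N : σ ≈ˢ negativeOn G N
  σ≈N u v p with joins-cases N u v
  ... | inj₁ (inj₁ uv∈N , eq) rewrite eq with q , s ← ∈N⇒- uv∈N =
    trans (cong (sign σ u v) (T-irrelevant p q)) s
  ... | inj₁ (inj₂ vu∈N , eq) rewrite eq with q , s ← ∈N⇒- vu∈N =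
    trans (sign-sym σ u v p q) s
  ... | inj₂ (uv∉N , vu∉N , eq) rewrite eq = ∉N⇒+ p uv∉N vu∉N

l≤lmax : ∀ {G} (σ : Signature G) → l (G ,ˢ σ) ≤ lmax G
l≤lmax {G} σ with τ , τ∈ , σ≈τ ← signatures-complete σ =
  subst (_≤ lmax G) (sym (l-cong σ τ σ≈τ))
    (All.lookup (xs≤max 0 _) (∈-map⁺ (λ σ → l (G ,ˢ σ)) τ∈))

{-# OPTIONS --safe #-}
-- The graph K₁ ∨ Sₙ consists of n − 1 triangles (pages) glued along a common edge, the spine.
-- A signature becomes balanced by deleting one edge from each negative page, or by deleting
-- the spine together with one edge from each positive page.  These sets have n elements in
-- total, so the smaller one has at most ⌊n/2⌋.  For −(K₁ ∨ Sₙ) the second set is the spine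
-- alone.  Conversely, let the signs of the pages alternate.  If the spine is kept, every
-- negative page has to lose one of its other edges; if the spine is deleted, the negative
-- 4-cycles formed by the pages 2j + 1 and 2j + 2 have to be hit as well, and they are
-- edge-disjoint.

module Submission where

open import Data.Fin.Base using (Fin; zero; suc; toℕ; fromℕ<; _<_)
open import Data.Fin.Properties using (_≟_; <-cmp; toℕ-fromℕ<)
open import Data.List.Base using (List; []; _∷_; _++_; map; filter; length; allFin; upTo)
open import Data.List.Extrema.Nat using (min≤xs; v≤min⁺; max≤v⁺)
open import Data.List.Membership.Propositional using (_∈_)
open import Data.List.Membership.Propositional.Properties using (∈-map⁺; ∈-++⁻; ∈-++⁺ˡ; ∈-++⁺ʳ; ∈-∃++; ∈-filter⁺; ∈-filter⁻; ∈-allFin; ∈-cartesianProduct⁺; ∈-upTo⁻)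
open import Data.List.Properties using (length-++; length-map; length-upTo; length-tabulate)
open import Data.List.Relation.Binary.Subset.Propositional using (_⊆_)
open import Data.List.Relation.Unary.All as All using ([]; _∷_)
open import Data.List.Relation.Unary.All.Properties using () renaming (map⁺ to All-map⁺)
open import Data.List.Relation.Unary.AllPairs using ([]; _∷_)
open import Data.List.Relation.Unary.Any using (Any; here; there; satisfied)
open import Data.List.Relation.Unary.Unique.Propositional using (Unique)
open import Data.List.Relation.Unary.Unique.Propositional.Properties using (allFin⁺; upTo⁺; filter⁺; cartesianProduct⁺)
open import Data.Nat.Base as ℕ using (ℕ; zero; suc; pred; parity; _+_; _*_; _⊔_; _≤_; z≤n; s≤s; s<s⁻¹; ⌊_/2⌋; ⌈_/2⌉)
open import Data.Nat.Properties using (+-suc; +-mono-≤; ⊔-comm; ≤-refl; ≤-reflexive; ≤-trans; ≤-antisym; ≤-<-trans; m≤n⇒m≤1+n; n≤1+n; 1+n≢n; ⌊n/2⌋-mono; n≡⌊n+n/2⌋; module ≤-Reasoning)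
open import Data.Parity.Base using (0ℙ; toSign)
open import Data.Product.Base using (_×_; _,_; proj₂; ∃-syntax; swap)
open import Data.Product.Properties using (≡-dec)
open import Data.Sign as Sign using (Sign)
open import Data.Sign.Properties using (*-assoc; *-comm; s*s≡+) renaming (_≟_ to _≟ˢ_)
open import Data.Sum.Base using (_⊎_; inj₁; inj₂; [_,_]′)
open import Data.Bool.Base using (true; false; T)
open import Data.Bool.Properties using (T-irrelevant)
open import Function.Base using (_∘_)
open import Relation.Binary.Construct.Closure.ReflexiveTransitive using (ε; _◅_)
open import Relation.Binary.Definitions using (tri<; tri≈; tri>)
open import Relation.Binary.PropositionalEquality using (_≡_; _≢_; refl; sym; trans; cong; cong₂; subst; module ≡-Reasoning)
open import Relation.Nullary using (¬_; yes; no; ¬?; contradiction)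
open import Relation.Unary using (Decidable)
open import Defs

import Data.List.Membership.DecPropositional as DecMembership

-- Counting, halving and signs

private
  variable
    A : Set

-- Removing one occurrence of the head from `ys` still leaves room for the tail of `xs`, because
-- uniqueness keeps the head out of that tail.
Unique-⊆⇒length≤ : {xs ys : List A} → Unique xs → xs ⊆ ys → length xs ≤ length ys
Unique-⊆⇒length≤ {xs = []}     _           _     = z≤n
Unique-⊆⇒length≤ {xs = x ∷ xs} (x∉xs ∷ u) xs⊆ with ∈-∃++ (xs⊆ (here refl))
... | as , bs , refl = begin
  suc (length xs)             ≤⟨ s≤s (Unique-⊆⇒length≤ u xs⊆as++bs) ⟩
  suc (length (as ++ bs))     ≡⟨ cong suc (length-++ as) ⟩
  suc (length as + length bs) ≡⟨ +-suc (length as) (length bs) ⟨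
  length as + suc (length bs) ≡⟨ length-++ as ⟨
  length (as ++ x ∷ bs)       ∎
  where
  open ≤-Reasoning
  xs⊆as++bs : xs ⊆ as ++ bs
  xs⊆as++bs y∈xs with ∈-++⁻ as (xs⊆ (there y∈xs))
  ... | inj₁ y∈as         = ∈-++⁺ˡ y∈as
  ... | inj₂ (here refl)  = contradiction refl (All.lookup x∉xs y∈xs)
  ... | inj₂ (there y∈bs) = ∈-++⁺ʳ as y∈bs

length-filter-disjoint : {P Q : A → Set} (P? : Decidable P) (Q? : Decidable Q) →
  (∀ x → P x → ¬ Q x) → ∀ xs → length (filter P? xs) + length (filter Q? xs) ≤ length xs
length-filter-disjoint P? Q? disj []       = z≤n
length-filter-disjoint P? Q? disj (x ∷ xs)
  with P? x | Q? x | length-filter-disjoint P? Q? disj xs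
... | yes p | yes q | _  = contradiction q (disj x p)
... | yes _ | no  _ | ih = s≤s ih
... | no  _ | yes _ | ih = ≤-trans (≤-reflexive (+-suc (length (filter P? xs)) _)) (s≤s ih)
... | no  _ | no  _ | ih = m≤n⇒m≤1+n ih

⌊n*2/2⌋≡n : ∀ n → ⌊ n * 2 /2⌋ ≡ n
⌊n*2/2⌋≡n zero    = refl
⌊n*2/2⌋≡n (suc n) = cong suc (⌊n*2/2⌋≡n n)

⌈n*2/2⌉≡n : ∀ n → ⌈ n * 2 /2⌉ ≡ n
⌈n*2/2⌉≡n zero    = refl
⌈n*2/2⌉≡n (suc n) = cong suc (⌈n*2/2⌉≡n n)

-- Ensures that the even page of each block below `⌈ t /2⌉` exists.
m<⌈n/2⌉⇒m*2<n : ∀ m n → m ℕ.< ⌈ n /2⌉ → m * 2 ℕ.< n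
m<⌈n/2⌉⇒m*2<n zero    (suc n)       _   = s≤s z≤n
m<⌈n/2⌉⇒m*2<n (suc m) (suc zero)    (s≤s ())
m<⌈n/2⌉⇒m*2<n (suc m) (suc (suc n)) m<  = s≤s (s≤s (m<⌈n/2⌉⇒m*2<n m n (s<s⁻¹ m<)))

parity[n*2] : ∀ n → parity (n * 2) ≡ 0ℙ
parity[n*2] zero    = refl
parity[n*2] (suc n) = parity[n*2] n

parity[1+n*2] : ∀ n → toSign (parity (suc (n * 2))) ≡ Sign.-
parity[1+n*2] zero    = refl
parity[1+n*2] (suc n) = parity[1+n*2] n

s*[s*t]≡t : ∀ s t → s Sign.* (s Sign.* t) ≡ t
s*[s*t]≡t s t = trans (sym (*-assoc s s t)) (cong (Sign._* t) (s*s≡+ s))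

-- The two products are opposite signs, and there are only two signs, so `p` equals one of them.
≢-≢-opposite : ∀ p s q → p ≢ s Sign.* q → ¬ p ≢ Sign.opposite s Sign.* q
≢-≢-opposite Sign.+ Sign.+ Sign.+ a _ = a refl
≢-≢-opposite Sign.+ Sign.+ Sign.- _ b = b refl
≢-≢-opposite Sign.+ Sign.- Sign.+ _ b = b refl
≢-≢-opposite Sign.+ Sign.- Sign.- a _ = a refl
≢-≢-opposite Sign.- Sign.+ Sign.+ _ b = b refl
≢-≢-opposite Sign.- Sign.+ Sign.- a _ = a refl
≢-≢-opposite Sign.- Sign.- Sign.+ a _ = a refl
≢-≢-opposite Sign.- Sign.- Sign.- _ b = b refl

-- Frustration index of an arbitrary signed graph

edges-unique : ∀ G → Unique (edges G)
edges-unique G = filter⁺ _ (cartesianProduct⁺ (allFin⁺ (order G)) (allFin⁺ (order G)))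

∈-edges : ∀ G {u v} → u < v → Adj G u v → (u , v) ∈ edges G
∈-edges G u<v p = ∈-filter⁺ _ (∈-cartesianProduct⁺ (∈-allFin _) (∈-allFin _)) (u<v , p)

Adj-sym : ∀ G {u v} → Adj G u v → Adj G v u
Adj-sym G {u} {v} = subst T (adj-sym G u v)

Adj⇒≢ : ∀ G {u} → ¬ Adj G u u
Adj⇒≢ G {u} = subst T (adj-irrefl G u)

-- Deletion ignores orientation, so an edge counts as hit when either of its two orientations is
-- listed.
Meets : ∀ {n} → List (Fin n × Fin n) → Fin n × Fin n → Set
Meets F e = e ∈ F ⊎ swap e ∈ F

─-Adj⇒¬Meets : ∀ G F {u v} → Adj (G ─ F) u v → ¬ Meets F (u , v)
─-Adj⇒¬Meets G F {u} {v} p m with adj G u v | joins-cases F u v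
... | true  | inj₁ (_ , eq) rewrite eq = p
... | true  | inj₂ (uv∉ , vu∉ , _)     = [ uv∉ , vu∉ ]′ m
... | false | _                        = p

Adj⇒Meets⊎─-Adj : ∀ G F u v → Adj G u v → Meets F (u , v) ⊎ Adj (G ─ F) u v
Adj⇒Meets⊎─-Adj G F u v p with adj G u v | joins-cases F u v
... | true | inj₁ (m , _)               = inj₁ m
... | true | inj₂ (_ , _ , eq) rewrite eq = inj₂ _

-- Along a walk every inner value of `θ` occurs twice and cancels; on a closed walk the square of
-- the value at the base remains.
switching⇒Balanced : ∀ (Σ : SignedGraph) (θ : Vertex (graph Σ) → Sign) →
  (∀ u v (p : Adj (graph Σ) u v) → sign (signature Σ) u v p ≡ θ u Sign.* θ v) →
  Balanced Σ
switching⇒Balanced (G ,ˢ σ) θ σ≡θθ c = trans (telescope (walk c)) (s*s≡+ (θ (base c)))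
  where
  telescope : ∀ {u v} (w : Walk G u v) → walkSign σ w ≡ θ u Sign.* θ v
  telescope {u} ε = sym (s*s≡+ (θ u))
  telescope {u} {v} (_◅_ {j = x} p w) = begin
    sign σ u x p Sign.* walkSign σ w               ≡⟨ cong₂ Sign._*_ (σ≡θθ u x p) (telescope w) ⟩
    (θ u Sign.* θ x) Sign.* (θ x Sign.* θ v)       ≡⟨ *-assoc (θ u) (θ x) _ ⟩
    θ u Sign.* (θ x Sign.* (θ x Sign.* θ v))       ≡⟨ cong (θ u Sign.*_) (s*[s*t]≡t (θ x) (θ v)) ⟩
    θ u Sign.* θ v                                 ∎
    where open ≡-Reasoning

-- Only sublists of `edges G` compete in the minimum, so `F` is replaced by the sublist of edges
-- lying in `F`. It has no repetitions, hence is no longer than `F`, whatever else `F` lists.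
l≤-switching : ∀ {G} (σ : Signature G) (θ : Vertex G → Sign) F →
  (∀ u v → u < v → (p : Adj G u v) → (u , v) ∈ F ⊎ sign σ u v p ≡ θ u Sign.* θ v) →
  l (G ,ˢ σ) ≤ length F
l≤-switching {G} σ θ F cover = ≤-trans
  (All.lookup (min≤xs _ _)
    (∈-map⁺ length (∈-filter⁺ (λ E → balanced? (delete (G ,ˢ σ) E))
                              (filter∈sublists (_∈? F) (edges G)) balanced)))
  (Unique-⊆⇒length≤ (filter⁺ (_∈? F) (edges-unique G))
                    (λ e∈F′ → proj₂ (∈-filter⁻ (_∈? F) {xs = edges G} e∈F′)))
  where
  open DecMembership (≡-dec (_≟_ {order G}) (_≟_ {order G})) using (_∈?_)

  F′ : List (Vertex G × Vertex G)
  F′ = filter (_∈? F) (edges G)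

  kept : ∀ {u v} → u < v → (p : Adj G u v) → ¬ (u , v) ∈ F′ → sign σ u v p ≡ θ u Sign.* θ v
  kept u<v p uv∉F′ with cover _ _ u<v p
  ... | inj₁ uv∈F = contradiction (∈-filter⁺ (_∈? F) (∈-edges G u<v p) uv∈F) uv∉F′
  ... | inj₂ eq   = eq

  switched : ∀ u v (p : Adj (G ─ F′) u v) →
             sign (signature (delete (G ,ˢ σ) F′)) u v p ≡ θ u Sign.* θ v
  switched u v p with <-cmp u v
  ... | tri< u<v _ _  = kept u<v _ (─-Adj⇒¬Meets G F′ p ∘ inj₁)
  ... | tri≈ _ refl _ = contradiction (─-Adj⇒Adj G F′ u u p) (Adj⇒≢ G)
  ... | tri> _ _ v<u  = begin
    sign σ u v q                ≡⟨ sign-sym σ u v q (Adj-sym G q) ⟩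
    sign σ v u (Adj-sym G q)    ≡⟨ kept v<u _ (─-Adj⇒¬Meets G F′ p ∘ inj₂) ⟩
    θ v Sign.* θ u              ≡⟨ *-comm (θ v) (θ u) ⟩
    θ u Sign.* θ v              ∎
    where
    open ≡-Reasoning
    q : Adj G u v
    q = ─-Adj⇒Adj G F′ u v p

  balanced : Balanced (delete (G ,ˢ σ) F′)
  balanced = switching⇒Balanced _ θ switched

-- A lower bound on `l` must also bound the default value of `min`, the size of the full edge set.
-- With no edge left, any switching function works.
delete-edges-balanced : ∀ {G} (σ : Signature G) → Balanced (delete (G ,ˢ σ) (edges G))
delete-edges-balanced {G} σ =
  switching⇒Balanced _ (λ _ → Sign.+) (λ u v p → contradiction p (empty u v))
  where
  empty : ∀ u v → ¬ Adj (G ─ edges G) u v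
  empty u v p with <-cmp u v | ─-Adj⇒Adj G (edges G) u v p
  ... | tri< u<v _ _  | q = ─-Adj⇒¬Meets G (edges G) p (inj₁ (∈-edges G u<v q))
  ... | tri≈ _ refl _ | q = Adj⇒≢ G q
  ... | tri> _ _ v<u  | q = ─-Adj⇒¬Meets G (edges G) p (inj₂ (∈-edges G v<u (Adj-sym G q)))

≤l : ∀ {G} (σ : Signature G) {k} →
     (∀ F → Balanced (delete (G ,ˢ σ) F) → k ≤ length F) → k ≤ l (G ,ˢ σ)
≤l {G} σ k≤ = v≤min⁺ (k≤ (edges G) (delete-edges-balanced σ))
  (All-map⁺ (All.tabulate λ {F} F∈ →
    k≤ F (proj₂ (∈-filter⁻ (λ E → balanced? (delete (G ,ˢ σ) E)) {xs = edgeSets G} F∈))))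

lmax≤ : ∀ G {k} → (∀ σ → l (G ,ˢ σ) ≤ k) → lmax G ≤ k
lmax≤ G l≤k = max≤v⁺ z≤n (All-map⁺ (All.tabulate {xs = signatures G} λ {σ} _ → l≤k σ))

steps : ∀ G {u v} → Walk G u v → List (Vertex G × Vertex G)
steps G ε                         = []
steps G (_◅_ {i = u} {j = v} _ w) = (u , v) ∷ steps G w

-- A surviving walk has to be rebuilt with adjacency proofs in `G ─ F`. Keeping its vertex list and
-- sign makes a cycle remain a cycle of the same sign.
meets-or-survives : ∀ {G} (σ : Signature G) F {u v} (w : Walk G u v) →
  Any (Meets F) (steps G w) ⊎
  ∃[ w′ ] (vertices (G ─ F) {u} {v} w′ ≡ vertices G w ×
           walkSign (signature (delete (G ,ˢ σ) F)) w′ ≡ walkSign σ w)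
meets-or-survives σ F ε = inj₂ (ε , refl , refl)
meets-or-survives {G} σ F (_◅_ {i = u} {j = x} p w)
  with Adj⇒Meets⊎─-Adj G F u x p | meets-or-survives σ F w
... | inj₁ m | _                    = inj₁ (here m)
... | inj₂ _ | inj₁ ms              = inj₁ (there ms)
... | inj₂ q | inj₂ (w′ , vs , s) = inj₂
  ( q ◅ w′ , cong (u ∷_) vs
  , cong₂ Sign._*_ (cong (sign σ u x) (T-irrelevant (─-Adj⇒Adj G F u x q) p)) s)

-- Otherwise the cycle would survive as a negative cycle of a balanced graph.
negative-cycle-meets : ∀ {G} (σ : Signature G) F → Balanced (delete (G ,ˢ σ) F) →
  (c : Cycle G) → cycleSign (G ,ˢ σ) c ≡ Sign.- → Any (Meets F) (steps G (walk c))
negative-cycle-meets σ F bal c neg with meets-or-survives σ F (walk c)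
... | inj₁ ms            = ms
... | inj₂ (w′ , vs , s) = contradiction
  (trans (sym (bal record
    { base     = base c
    ; walk     = w′
    ; distinct = subst Unique (sym vs) (distinct c)
    ; long     = subst (λ xs → 3 ≤ length xs) (sym vs) (long c)
    })) (trans s neg))
  λ ()

-- Books of triangles

book : ℕ → Graph
book t = K 1 ∨ S (suc t)

-- The vertex of `K 1`, the centre of the star, and its leaves: `a b` is the spine, and page `x` is
-- the triangle on `a`, `b`, `c x`.
pattern a   = zero
pattern b   = suc zero
pattern c x = suc (suc x)

module _ (t : ℕ) where

  private
    G : Graph
    G = book t

  triangle : Fin t → Cycle G
  triangle x = record
    { base     = a
    ; walk     = _◅_ {j = b} _ (_◅_ {j = c x} _ (_◅_ {j = a} _ ε))
    ; distinct = ((λ ()) ∷ (λ ()) ∷ []) ∷ ((λ ()) ∷ []) ∷ [] ∷ []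
    ; long     = ≤-refl
    }

  square : (x y : Fin t) → x ≢ y → Cycle G
  square x y x≢y = record
    { base     = a
    ; walk     = _◅_ {j = c x} _ (_◅_ {j = b} _ (_◅_ {j = c y} _ (_◅_ {j = a} _ ε)))
    ; distinct = ((λ ()) ∷ (λ ()) ∷ (λ ()) ∷ []) ∷ ((λ ()) ∷ (λ { refl → x≢y refl }) ∷ [])
                 ∷ ((λ ()) ∷ []) ∷ [] ∷ []
    ; long     = n≤1+n 3
    }

  -- The minimum of two deletion sets is bounded through their sum: twice the frustration index is
  -- at most `t + 1`.
  l≤⌈t/2⌉ : (σ : Signature G) → l (G ,ˢ σ) ≤ ⌈ t /2⌉
  l≤⌈t/2⌉ σ = begin
    l (G ,ˢ σ)                             ≡⟨ n≡⌊n+n/2⌋ _ ⟩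
    ⌊ l (G ,ˢ σ) + l (G ,ˢ σ) /2⌋          ≤⟨ ⌊n/2⌋-mono (+-mono-≤ keep-spine delete-spine) ⟩
    ⌊ # s + suc (# s̄) /2⌋                  ≡⟨ cong ⌊_/2⌋ (+-suc (# s) (# s̄)) ⟩
    ⌈ # s + # s̄ /2⌉                        ≤⟨ ⌊n/2⌋-mono (s≤s counts) ⟩
    ⌈ t /2⌉                                ∎
    where
    open ≤-Reasoning

    s s̄ : Sign
    s = sign σ a b _
    s̄ = Sign.opposite s

    p q : Fin t → Sign
    p x = sign σ a (c x) _
    q x = sign σ b (c x) _

    -- A page is bad for `r` if its triangle would be negative with a spine of sign `r`. So `# s`
    -- counts the negative pages and `# s̄` the positive ones.
    bad? : ∀ r → Decidable (λ x → p x ≢ r Sign.* q x)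
    bad? r x = ¬? (p x ≟ˢ r Sign.* q x)

    # : Sign → ℕ
    # r = length (filter (bad? r) (allFin t))

    cut : Sign → List (Vertex G × Vertex G)
    cut r = map (λ x → a , c x) (filter (bad? r) (allFin t))

    -- The value at `c x` is chosen to fit the edge from `b`; then the edge from `a` fails exactly
    -- on bad pages, and the spine fails exactly if its sign is not `r`.
    θ : Sign → Vertex G → Sign
    θ r a     = Sign.+
    θ r b     = r
    θ r (c x) = r Sign.* q x

    cover : ∀ r F → cut r ⊆ F → (a , b) ∈ F ⊎ s ≡ r → ∀ u v → u < v → (e : Adj G u v) →
            (u , v) ∈ F ⊎ sign σ u v e ≡ θ r u Sign.* θ r v
    cover r F cut⊆F spine a b     _ _ = spine
    cover r F cut⊆F spine a (c x) _ _ with p x ≟ˢ r Sign.* q x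
    ... | yes eq = inj₂ eq
    ... | no  ne = inj₁ (cut⊆F (∈-map⁺ _ (∈-filter⁺ (bad? r) (∈-allFin x) ne)))
    cover r F cut⊆F spine b (c x) _ _ = inj₂ (sym (s*[s*t]≡t r (q x)))
    cover r F cut⊆F spine b b (s≤s ()) _
    cover r F cut⊆F spine (c _) b (s≤s ()) _
    cover r F cut⊆F spine (c _) (c _) _ ()

    keep-spine : l (G ,ˢ σ) ≤ # s
    keep-spine = ≤-trans
      (l≤-switching σ (θ s) (cut s) (cover s (cut s) (λ e∈ → e∈) (inj₂ refl)))
      (≤-reflexive (length-map _ (filter (bad? s) (allFin t))))

    delete-spine : l (G ,ˢ σ) ≤ suc (# s̄)
    delete-spine = ≤-trans
      (l≤-switching σ (θ s̄) ((a , b) ∷ cut s̄) (cover s̄ _ there (inj₁ (here refl))))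
      (≤-reflexive (cong suc (length-map _ (filter (bad? s̄) (allFin t)))))

    counts : # s + # s̄ ≤ t
    counts = ≤-trans
      (length-filter-disjoint (bad? s) (bad? s̄) (λ x → ≢-≢-opposite (p x) s (q x)) (allFin t))
      (≤-reflexive (length-tabulate _))

  -- Without the spine the graph is bipartite, with `a` and `b` on one side and the leaves on the
  -- other.
  l[-book]≤1 : l (- G) ≤ 1
  l[-book]≤1 = l≤-switching (signature (- G)) θ ((a , b) ∷ []) cover
    where
    θ : Vertex G → Sign
    θ (c _) = Sign.-
    θ _     = Sign.+

    cover : ∀ u v → u < v → Adj G u v → (u , v) ∈ (a , b) ∷ [] ⊎ Sign.- ≡ θ u Sign.* θ v
    cover a b     _ _ = inj₁ (here refl)
    cover a (c _) _ _ = inj₂ refl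
    cover b (c _) _ _ = inj₂ refl
    cover b b (s≤s ()) _
    cover (c _) b (s≤s ()) _
    cover (c _) (c _) _ ()

  -- Page x is negative exactly for even x.

  alternating : Signature G
  alternating = record { sign = λ u v _ → f u v ; sign-sym = λ u v _ _ → f-sym u v }
    where
    f : Vertex G → Vertex G → Sign
    f a b     = Sign.-
    f b a     = Sign.-
    f a (c x) = toSign (parity (toℕ x))
    f (c x) a = toSign (parity (toℕ x))
    f _ _     = Sign.+

    f-sym : ∀ u v → f u v ≡ f v u
    f-sym a a         = refl
    f-sym a b         = refl
    f-sym a (c _)     = refl
    f-sym b a         = refl
    f-sym b b         = refl
    f-sym b (c _)     = refl
    f-sym (c _) a     = refl
    f-sym (c _) b     = refl
    f-sym (c _) (c _) = refl

  -- The spine lies in block 0 and the edges at c x lie in block ⌈x/2⌉, so that a block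
  -- contains at most one negative page and the two pages of a negative 4-cycle agree.

  block : Vertex G × Vertex G → ℕ
  block (u , v) = pred ⌈ toℕ u ⊔ toℕ v /2⌉

  -- Taking the larger endpoint makes `block` independent of orientation.
  Meets⇒block∈ : ∀ F {e} → Meets F e → block e ∈ map block F
  Meets⇒block∈ F {e} (inj₁ e∈F) = ∈-map⁺ block e∈F
  Meets⇒block∈ F {u , v} (inj₂ e∈F) =
    subst (_∈ map block F) (cong (pred ∘ ⌈_/2⌉) (⊔-comm (toℕ v) (toℕ u))) (∈-map⁺ block e∈F)

  -- Page `2j` is a negative triangle, and both of its edges off the spine lie in block `j`.
  even-page : ∀ F → Balanced (delete (G ,ˢ alternating) F) → ¬ Meets F (a , b) →
              ∀ j (x : Fin t) → toℕ x ≡ j * 2 → j ∈ map block F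
  even-page F bal ¬spine j x x≡ = go (negative-cycle-meets alternating F bal (triangle x) negative)
    where
    negative : cycleSign (G ,ˢ alternating) (triangle x) ≡ Sign.-
    negative rewrite x≡ | parity[n*2] j = refl

    found : ∀ {e} → Meets F e → block e ≡ ⌈ toℕ x /2⌉ → j ∈ map block F
    found m eq = subst (_∈ map block F)
      (trans eq (trans (cong ⌈_/2⌉ x≡) (⌈n*2/2⌉≡n j))) (Meets⇒block∈ F m)

    go : Any (Meets F) ((a , b) ∷ (b , c x) ∷ (c x , a) ∷ []) → j ∈ map block F
    go (here m)                 = contradiction m ¬spine
    -- Both equations hold by computation: `c x` has index `x + 2`, and `pred` undoes this shift
    -- after halving.
    go (there (here m))         = found m refl
    go (there (there (here m))) = found m refl

  -- The 4-cycle formed by a positive and a negative page is negative; it avoids the spine, and all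
  -- four edges lie in block `j + 1`.
  page-pair : ∀ F → Balanced (delete (G ,ˢ alternating) F) →
              ∀ j (x y : Fin t) → toℕ x ≡ suc (j * 2) → toℕ y ≡ suc j * 2 →
              suc j ∈ map block F
  page-pair F bal j x y x≡ y≡ =
    go (negative-cycle-meets alternating F bal (square x y x≢y) negative)
    where
    x≢y : x ≢ y
    x≢y refl = 1+n≢n (trans (sym y≡) x≡)

    negative : cycleSign (G ,ˢ alternating) (square x y x≢y) ≡ Sign.-
    negative rewrite x≡ | y≡ | parity[1+n*2] j | parity[n*2] j = refl

    at-x : ∀ {e} → Meets F e → block e ≡ ⌈ toℕ x /2⌉ → suc j ∈ map block F
    at-x m eq = subst (_∈ map block F)
      (trans eq (trans (cong ⌈_/2⌉ x≡) (cong suc (⌊n*2/2⌋≡n j)))) (Meets⇒block∈ F m)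

    at-y : ∀ {e} → Meets F e → block e ≡ ⌈ toℕ y /2⌉ → suc j ∈ map block F
    at-y m eq = subst (_∈ map block F)
      (trans eq (trans (cong ⌈_/2⌉ y≡) (⌈n*2/2⌉≡n (suc j)))) (Meets⇒block∈ F m)

    go : Any (Meets F) ((a , c x) ∷ (c x , b) ∷ (b , c y) ∷ (c y , a) ∷ []) → suc j ∈ map block F
    go (here m)                         = at-x m refl
    go (there (here m))                 = at-x m refl
    go (there (there (here m)))         = at-y m refl
    go (there (there (there (here m)))) = at-y m refl

  -- Each block below `⌈ t /2⌉` must contain an entry of `F`, and one entry lies in only one block.
  ⌈t/2⌉≤l[alternating] : ⌈ t /2⌉ ≤ l (G ,ˢ alternating)
  ⌈t/2⌉≤l[alternating] = ≤l alternating λ F bal → begin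
    ⌈ t /2⌉                ≡⟨ length-upTo ⌈ t /2⌉ ⟨
    length (upTo ⌈ t /2⌉)  ≤⟨ Unique-⊆⇒length≤ (upTo⁺ ⌈ t /2⌉) (block-used F bal _ ∘ ∈-upTo⁻) ⟩
    length (map block F)   ≡⟨ length-map block F ⟩
    length F               ∎
    where
    open ≤-Reasoning

    block-used : ∀ F → Balanced (delete (G ,ˢ alternating) F) →
                 ∀ j → j ℕ.< ⌈ t /2⌉ → j ∈ map block F
    block-used F bal j j< with joins-cases F a b | m<⌈n/2⌉⇒m*2<n j t j<
    block-used F bal j       j< | inj₂ (ab∉ , ba∉ , _) | 2j<t =
      even-page F bal [ ab∉ , ba∉ ]′ j (fromℕ< 2j<t) (toℕ-fromℕ< 2j<t)
    -- The deleted spine itself accounts for block 0.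
    block-used F bal zero    j< | inj₁ (m , _) | _     = Meets⇒block∈ F m
    block-used F bal (suc j) j< | inj₁ _       | 2j+2<t =
      page-pair F bal j (fromℕ< 2j+1<t) (fromℕ< 2j+2<t) (toℕ-fromℕ< 2j+1<t) (toℕ-fromℕ< 2j+2<t)
      where
      2j+1<t : suc (j * 2) ℕ.< t
      2j+1<t = ≤-<-trans (n≤1+n _) 2j+2<t

  lmax[book]≡⌈t/2⌉ : lmax G ≡ ⌈ t /2⌉
  lmax[book]≡⌈t/2⌉ = ≤-antisym (lmax≤ G l≤⌈t/2⌉)
    (≤-trans ⌈t/2⌉≤l[alternating] (l≤lmax {G} alternating))

-- The first page is a negative triangle, so deleting nothing does not balance the graph.
1≤l[-book] : ∀ t → 1 ≤ l (- book (suc t))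
1≤l[-book] t = ≤l σ nonempty
  where
  σ : Signature (book (suc t))
  σ = signature (- book (suc t))

  nonempty : ∀ F → Balanced (delete (book (suc t) ,ˢ σ) F) → 1 ≤ length F
  nonempty []      bal with satisfied (negative-cycle-meets σ [] bal (triangle _ zero) refl)
  ... | _ , inj₁ ()
  ... | _ , inj₂ ()
  nonempty (_ ∷ _) _   = s≤s z≤n

corollary13 : (n : ℕ) → 2 ≤ n →
    l (- (K 1 ∨ S n)) ≡ 1 × lmax (K 1 ∨ S n) ≡ ⌊ n /2⌋
-- With `n = t + 2` there are `t + 1` pages, and `⌈ suc t /2⌉` is `⌊ n /2⌋` by definition.
corollary13 (suc (suc t)) (s≤s (s≤s _)) =
  ≤-antisym (l[-book]≤1 (suc t)) (1≤l[-book] t) , lmax[book]≡⌈t/2⌉ (suc t)
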